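{- Let $n\ge 3$ be an integer with $n\ne 6$. If there exists a symmetric Hadamard matrix of order $2n-2$ with all diagonal entries equal to $1$, then $$R(B_{n-2},B_n)\ge 4n-3.$$
   Context: For a positive integer $n$, the book graph $B_n=K_2+\overline{K}_n$ is the graph consisting of $n$ triangles sharing a common edge. The Ramsey number $R(B_m,B_n)$ is the smallest integer $N$ such that every red/blue coloring of the edges of $K_N$ contains a red copy of $B_m$ or a blue copy of $B_n$ (copies are as not necessarily induced subgraphs). A Hadamard matrix of order $N$ is an $N\times N$ matrix $H=(h_{ij})$ with all $h_{ij}\in\{+1,-1\}$ and $HH^{\mathsf T}=NI$; it is symmetric if $H=H^{\mathsf T}$. -}

module Defs where

open import Data.Empty using (⊥-elim)
open import Data.Fin using (Fin; zero; suc; splitAt)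
open import Data.Fin.Properties using (all?; any?) renaming (_≟_ to _≟ᶠ_)
open import Data.Integer using (ℤ; 0ℤ; 1ℤ; -1ℤ)
import Data.Integer as ℤ
import Data.Integer.Properties as ℤ
open import Data.List using (List; []; _∷_; length; filter; lookup; allFin)
open import Data.List.Properties using (length-tabulate)
open import Data.List.Membership.Propositional using (_∈_)
open import Data.List.Membership.Propositional.Properties using (∈-filter⁻; ∈-lookup)
open import Data.List.Relation.Unary.All as All using (All; []; _∷_)
open import Data.List.Relation.Unary.AllPairs using (AllPairs; []; _∷_)
import Data.List.Relation.Unary.AllPairs.Properties as AllPairs
open import Data.List.Relation.Unary.Any using (here; there)
open import Data.List.Relation.Unary.Unique.Propositional.Properties using (allFin⁺)
open import Data.Nat using (ℕ; zero; suc; _+_; _*_; _∸_; _^_; _≤_; _<_; z≤n; s≤s)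
open import Data.Nat.Properties
open import Data.Product using (∃; _×_; _,_; proj₁; proj₂)
open import Data.Sum using (_⊎_; inj₁; inj₂)
open import Data.Unit using (⊤; tt)
import Data.Vec.Functional as Vector
open import Function using (_∘_)
open import Function.Definitions using (Injective)
open import Level using (0ℓ)
open import Relation.Binary using (Rel; Decidable; Irreflexive; Symmetric; _Respects_; Reflexive)
open import Relation.Binary.PropositionalEquality
open import Relation.Nullary using (Dec; yes; no; ¬_)
open import Relation.Nullary.Decidable using (map′; ¬?; _×-dec_; _⊎-dec_; _→-dec_; decidable-stable)

open import Algebra.Properties.CommutativeMonoid.Sum ℤ.+-0-commutativeMonoid using (sum)

record Graph (p : ℕ) : Set₁ where
  field
    Adj     : Rel (Fin p) 0ℓ
    adj?    : Decidable Adj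
    symm    : Symmetric Adj
    irrefl  : Irreflexive _≡_ Adj

open Graph public

K : (p : ℕ) → Graph p
K p = record
  { Adj    = _≢_
  ; adj?   = λ x y → ¬? (x ≟ᶠ y)
  ; symm   = λ x≢y → x≢y ∘ sym
  ; irrefl = λ x≡y x≢y → x≢y x≡y
  }

complement : ∀ {p} → Graph p → Graph p
complement G = record
  { Adj    = λ x y → x ≢ y × ¬ Adj G x y
  ; adj?   = λ x y → ¬? (x ≟ᶠ y) ×-dec ¬? (adj? G x y)
  ; symm   = λ (x≢y , ¬xy) → x≢y ∘ sym , ¬xy ∘ symm G
  ; irrefl = λ x≡y (x≢y , _) → x≢y x≡y
  }

-- The join of G and H has the first p vertices carrying G, the last q
-- carrying H, and every edge between the two parts.
module _ {p q : ℕ} (G : Graph p) (H : Graph q) where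

  JoinAdj : Rel (Fin p ⊎ Fin q) 0ℓ
  JoinAdj (inj₁ x) (inj₁ y) = Adj G x y
  JoinAdj (inj₁ x) (inj₂ y) = ⊤
  JoinAdj (inj₂ x) (inj₁ y) = ⊤
  JoinAdj (inj₂ x) (inj₂ y) = Adj H x y

  joinAdj? : Decidable JoinAdj
  joinAdj? (inj₁ x) (inj₁ y) = adj? G x y
  joinAdj? (inj₁ x) (inj₂ y) = yes tt
  joinAdj? (inj₂ x) (inj₁ y) = yes tt
  joinAdj? (inj₂ x) (inj₂ y) = adj? H x y

  joinAdj-symm : Symmetric JoinAdj
  joinAdj-symm {inj₁ x} {inj₁ y} = symm G
  joinAdj-symm {inj₁ x} {inj₂ y} = λ _ → tt
  joinAdj-symm {inj₂ x} {inj₁ y} = λ _ → tt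
  joinAdj-symm {inj₂ x} {inj₂ y} = symm H

  joinAdj-irrefl : Irreflexive _≡_ JoinAdj
  joinAdj-irrefl {inj₁ x} refl = irrefl G refl
  joinAdj-irrefl {inj₂ x} refl = irrefl H refl

  join : Graph (p + q)
  join = record
    { Adj    = λ x y → JoinAdj (splitAt p x) (splitAt p y)
    ; adj?   = λ x y → joinAdj? (splitAt p x) (splitAt p y)
    ; symm   = λ {x} {y} → joinAdj-symm {splitAt p x} {splitAt p y}
    ; irrefl = λ { {x} refl → joinAdj-irrefl {splitAt p x} refl }
    }

Book : (n : ℕ) → Graph (2 + n)
Book n = join (K 2) (complement (K n))

IsCopy : ∀ {p q} → Graph p → Graph q → (Fin p → Fin q) → Set
IsCopy G H f = Injective _≡_ _≡_ f × (∀ x y → Adj G x y → Adj H (f x) (f y))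

Contains : ∀ {p q} → Graph q → Graph p → Set
Contains H G = ∃ (IsCopy G H)

data Colour : Set where
  red blue : Colour

_≟ᶜ_ : Decidable {A = Colour} _≡_
red  ≟ᶜ red  = yes refl
red  ≟ᶜ blue = no λ ()
blue ≟ᶜ red  = no λ ()
blue ≟ᶜ blue = yes refl

-- The edge {i , j} of K_N gets the colour of either ordered pair; the
-- values on the diagonal are junk and are ignored by colourClass.
record Colouring (N : ℕ) : Set where
  constructor colouring
  field
    colour     : Fin N → Fin N → Colour
    colour-sym : ∀ i j → colour i j ≡ colour j i

open Colouring public

colourClass : ∀ {N} → Colouring N → Colour → Graph N
colourClass χ c = record
  { Adj    = λ i j → i ≢ j × colour χ i j ≡ c
  ; adj?   = λ i j → ¬? (i ≟ᶠ j) ×-dec (colour χ i j ≟ᶜ c)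
  ; symm   = λ {i} {j} (i≢j , e) → i≢j ∘ sym , trans (colour-sym χ j i) e
  ; irrefl = λ i≡j (i≢j , _) → i≢j i≡j
  }

Unavoidable : ∀ {p q} → Graph p → Graph q → ℕ → Set
Unavoidable G H N = (χ : Colouring N) →
  Contains (colourClass χ red) G ⊎ Contains (colourClass χ blue) H

IsRamseyNumber : ∀ {p q} → Graph p → Graph q → ℕ → Set
IsRamseyNumber G H N = Unavoidable G H N × (∀ M → Unavoidable G H M → N ≤ M)

-- From here to R: finite Ramsey (with the bound 2 ^ (p + q)) together
-- with decidability of Unavoidable, so that the least N exists and R is
-- a total function.  Without function extensionality, functions on Fin n
-- are searched only for predicates respecting pointwise equality.

Searchable : {A : Set} → Rel A 0ℓ → Set₁
Searchable {A} _≈_ = {P : A → Set} → P Respects _≈_ → (∀ x → Dec (P x)) → Dec (∃ P)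

search-Fin : ∀ {n} → Searchable (_≡_ {A = Fin n})
search-Fin _ = any?

search-Colour : Searchable (_≡_ {A = Colour})
search-Colour {P} _ P? = map′ to from (P? red ⊎-dec P? blue)
  where
  to : P red ⊎ P blue → ∃ P
  to (inj₁ p) = red , p
  to (inj₂ p) = blue , p
  from : ∃ P → P red ⊎ P blue
  from (red  , p) = inj₁ p
  from (blue , p) = inj₂ p

search-→ : ∀ {A : Set} {_≈_ : Rel A 0ℓ} → Reflexive _≈_ → Searchable _≈_ →
           ∀ {n} → Searchable {Fin n → A} (λ f g → ∀ i → f i ≈ g i)
search-→ rfl search {zero}  respects P? =
  map′ (λ p → Vector.[] , p) (λ (_ , p) → respects (λ ()) p) (P? Vector.[])
search-→ rfl search {suc n} respects P? =
  map′ (λ (a , f , p) → a Vector.∷ f , p)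
       (λ (f , p) → f zero , f ∘ suc , respects (λ { zero → rfl ; (suc i) → rfl }) p)
       (search (λ a≈b (f , p) → f , respects (λ { zero → a≈b ; (suc i) → rfl }) p)
               (λ a → search-→ rfl search
                 (λ f≈g → respects (λ { zero → rfl ; (suc i) → f≈g i }))
                 (λ f → P? (a Vector.∷ f))))

contains? : ∀ {p q} (H : Graph q) (G : Graph p) → Dec (Contains H G)
contains? H G = search-→ refl search-Fin respects dec
  where
  respects : ∀ {f g} → (∀ i → f i ≡ g i) → IsCopy G H f → IsCopy G H g
  respects f≗g (inj , hom) =
    (λ {x} {y} e → inj (trans (f≗g x) (trans e (sym (f≗g y))))) ,
    (λ x y xy → subst₂ (Adj H) (f≗g x) (f≗g y) (hom x y xy))
  dec : ∀ f → Dec (IsCopy G H f)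
  dec f = map′ (λ h {x} {y} → h x y) (λ h x y → h)
               (all? λ x → all? λ y → (f x ≟ᶠ f y) →-dec (x ≟ᶠ y))
          ×-dec (all? λ x → all? λ y → adj? G x y →-dec adj? H (f x) (f y))

Contains-mono : ∀ {p q} {G : Graph p} {H H′ : Graph q} →
                (∀ {x y} → Adj H x y → Adj H′ x y) → Contains H G → Contains H′ G
Contains-mono H⊆H′ (f , inj , hom) = f , inj , λ x y xy → H⊆H′ (hom x y xy)

module _ {p q : ℕ} (G : Graph p) (H : Graph q) where

  Good : ∀ {N} → Colouring N → Set
  Good χ = Contains (colourClass χ red) G ⊎ Contains (colourClass χ blue) H

  good? : ∀ {N} (χ : Colouring N) → Dec (Good χ)
  good? χ = contains? (colourClass χ red) G ⊎-dec contains? (colourClass χ blue) H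

  Good-respects : ∀ {N} (χ χ′ : Colouring N) → (∀ i j → colour χ i j ≡ colour χ′ i j) →
              Good χ → Good χ′
  Good-respects χ χ′ e (inj₁ c) = inj₁ (Contains-mono
    {G = G} {colourClass χ red} {colourClass χ′ red}
    (λ (x≢y , r) → x≢y , trans (sym (e _ _)) r) c)
  Good-respects χ χ′ e (inj₂ c) = inj₂ (Contains-mono
    {G = H} {colourClass χ blue} {colourClass χ′ blue}
    (λ (x≢y , r) → x≢y , trans (sym (e _ _)) r) c)

  unavoidable? : ∀ N → Dec (Unavoidable G H N)
  unavoidable? N = map′ {A = ¬ ∃ Bad}
    (λ ¬bad χ → decidable-stable (good? χ) λ ¬good → ¬bad (colour χ , colour-sym χ , ¬good))
    (λ u (c , s , ¬good) → ¬good (u (colouring c s)))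
    (¬? (search-→ (λ _ → refl) (search-→ refl search-Colour) respects dec))
    where
    Bad : (Fin N → Fin N → Colour) → Set
    Bad c = ∃ λ (s : ∀ i j → c i j ≡ c j i) → ¬ Good (colouring c s)
    respects : ∀ {c d} → (∀ i j → c i j ≡ d i j) → Bad c → Bad d
    respects {c} {d} e (s , ¬good) = s′ , ¬good ∘ Good-respects (colouring d s′) (colouring c s) λ i j → sym (e i j)
      where
      s′ : ∀ i j → d i j ≡ d j i
      s′ i j = trans (sym (e i j)) (trans (s i j) (e j i))
    dec : ∀ c → Dec (Bad c)
    dec c with all? (λ i → all? λ j → c i j ≟ᶜ c j i)
    ... | no ¬s = no (¬s ∘ proj₁)
    ... | yes s = map′ (s ,_) (λ (s′ , ¬good) → ¬good ∘ Good-respects (colouring c s) (colouring c s′) λ _ _ → refl)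
                       (¬? (good? (colouring c s)))

module _ {N : ℕ} (χ : Colouring N) where

  Mono : Colour → Fin N → Fin N → Set
  Mono c = Adj (colourClass χ c)

  Clique : Colour → ℕ → List (Fin N) → Set
  Clique c k xs = ∃ λ ys → length ys ≡ k × AllPairs (Mono c) ys × All (_∈ xs) ys

  side : ∀ c x → List (Fin N) → List (Fin N)
  side c x = filter (λ y → colour χ x y ≟ᶜ c)

  length-sides : ∀ x xs → length (side red x xs) + length (side blue x xs) ≡ length xs
  length-sides x [] = refl
  length-sides x (y ∷ ys) with colour χ x y
  ... | red  = cong suc (length-sides x ys)
  ... | blue = trans (+-suc _ _) (cong suc (length-sides x ys))

  weaken : ∀ {c c′ k x xs} → Clique c k (side c′ x xs) → Clique c k (x ∷ xs)
  weaken {c′ = c′} {x = x} (ys , len , cl , ys⊆) =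
    ys , len , cl , All.map (there ∘ proj₁ ∘ ∈-filter⁻ (λ y → colour χ x y ≟ᶜ c′)) ys⊆

  extend : ∀ {c k x xs} → All (x ≢_) xs → Clique c k (side c x xs) → Clique c (suc k) (x ∷ xs)
  extend {c} {x = x} {xs} x∉ (ys , len , cl , ys⊆) =
    x ∷ ys , cong suc len , All.map new ys⊆ ∷ cl ,
    here refl ∷ proj₂ (proj₂ (proj₂ (weaken {c} (ys , len , cl , ys⊆))))
    where
    new : ∀ {y} → y ∈ side c x xs → Mono c x y
    new y∈ with y∈xs , e ← ∈-filter⁻ (λ y → colour χ x y ≟ᶜ c) y∈ = All.lookup x∉ y∈xs , e

  cliques-exist : ∀ s t xs → AllPairs _≢_ xs → 2 ^ (s + t) ≤ length xs → Clique red s xs ⊎ Clique blue t xs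
  cliques-exist zero    t       xs uniq le = inj₁ ([] , refl , [] , [])
  cliques-exist (suc s) zero    xs uniq le = inj₂ ([] , refl , [] , [])
  cliques-exist (suc s) (suc t) [] uniq le = ⊥-elim (<⇒≱ (m^n>0 2 (suc s + suc t)) le)
  cliques-exist (suc s) (suc t) (x ∷ xs) (x∉ ∷ uniq) le
    with 2 ^ (s + suc t) ≤? length (side red x xs)
  ... | yes leʳ with cliques-exist s (suc t) (side red x xs) (AllPairs.filter⁺ _ uniq) leʳ
  ...   | inj₁ cl = inj₁ (extend x∉ cl)
  ...   | inj₂ cl = inj₂ (weaken cl)
  cliques-exist (suc s) (suc t) (x ∷ xs) (x∉ ∷ uniq) le | no gtʳ
    with 2 ^ (suc s + t) ≤? length (side blue x xs)
  ... | yes leᵇ with cliques-exist (suc s) t (side blue x xs) (AllPairs.filter⁺ _ uniq) leᵇ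
  ...   | inj₁ cl = inj₁ (weaken cl)
  ...   | inj₂ cl = inj₂ (extend x∉ cl)
  cliques-exist (suc s) (suc t) (x ∷ xs) (x∉ ∷ uniq) le | no gtʳ | no gtᵇ = ⊥-elim (<⇒≱ short le)
    where
    open ≤-Reasoning
    short : suc (length xs) < 2 ^ (suc s + suc t)
    short = begin-strict
      suc (length xs)                    ≡⟨ cong suc (length-sides x xs) ⟨
      suc (length (side red x xs)) + length (side blue x xs)
        <⟨ +-mono-≤-< (≰⇒> gtʳ) (≰⇒> gtᵇ) ⟩
      2 ^ (s + suc t) + 2 ^ (suc s + t)  ≡⟨ cong (λ k → 2 ^ (s + suc t) + 2 ^ k) (+-suc s t) ⟨
      2 ^ (s + suc t) + 2 ^ (s + suc t)  ≡⟨ cong (2 ^ (s + suc t) +_) (+-identityʳ _) ⟨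
      2 ^ (suc s + suc t)                ∎

  lookup-clique : ∀ {c ys} → AllPairs (Mono c) ys → ∀ i j → i ≢ j → Mono c (lookup ys i) (lookup ys j)
  lookup-clique     (_ ∷ _)  zero    zero    i≢j = ⊥-elim (i≢j refl)
  lookup-clique     (a ∷ _)  zero    (suc j) i≢j = All.lookup a (∈-lookup j)
  lookup-clique {c} (a ∷ _)  (suc i) zero    i≢j =
    symm (colourClass χ c) (All.lookup a (∈-lookup i))
  lookup-clique     (_ ∷ cl) (suc i) (suc j) i≢j = lookup-clique cl i j (i≢j ∘ cong suc)

  clique⇒contains : ∀ {c p xs} (G : Graph p) → Clique c p xs → Contains (colourClass χ c) G
  clique⇒contains {c} G (ys , refl , cl , _) = lookup ys , inj , hom
    where
    inj : Injective _≡_ _≡_ (lookup ys)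
    inj {i} {j} e = decidable-stable (i ≟ᶠ j) λ i≢j → proj₁ (lookup-clique {c} cl i j i≢j) e
    hom : ∀ i j → Adj G i j → Mono c (lookup ys i) (lookup ys j)
    hom i j ij = lookup-clique cl i j λ i≡j → irrefl G i≡j ij

least : ∀ {P : ℕ → Set} → (∀ n → Dec (P n)) → ∀ n → P n → ∃ λ m → P m × (∀ k → P k → m ≤ k)
least P? zero    p = zero , p , λ _ _ → z≤n
least P? (suc n) p with P? zero
... | yes p₀ = zero , p₀ , λ _ _ → z≤n
... | no ¬p₀ with m , pm , min ← least (P? ∘ suc) n p =
  suc m , pm , λ { zero p₀ → ⊥-elim (¬p₀ p₀) ; (suc k) pk → s≤s (min k pk) }

abstract
  ramseyNumber-exists : ∀ {p q} (G : Graph p) (H : Graph q) → ∃ (IsRamseyNumber G H)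
  ramseyNumber-exists {p} {q} G H = least (unavoidable? G H) N unavoidable
    where
    N : ℕ
    N = 2 ^ (p + q)
    unavoidable : Unavoidable G H N
    unavoidable χ
      with cliques-exist χ p q (allFin N) (allFin⁺ N) (≤-reflexive (sym (length-tabulate {n = N} (λ i → i))))
    ... | inj₁ cl = inj₁ (clique⇒contains χ G cl)
    ... | inj₂ cl = inj₂ (clique⇒contains χ H cl)

R : ∀ {p q} → Graph p → Graph q → ℕ
R G H = proj₁ (ramseyNumber-exists G H)

R-isRamseyNumber : ∀ {p q} (G : Graph p) (H : Graph q) → IsRamseyNumber G H (R G H)
R-isRamseyNumber G H = proj₂ (ramseyNumber-exists G H)

Matrix : ℕ → Set
Matrix N = Fin N → Fin N → ℤ

_ᵀ : ∀ {N} → Matrix N → Matrix N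
(A ᵀ) i j = A j i

_·_ : ∀ {N} → Matrix N → Matrix N → Matrix N
(A · B) i j = sum λ k → A i k ℤ.* B k j

I : ∀ {N} → Matrix N
I i j with i ≟ᶠ j
... | yes _ = 1ℤ
... | no  _ = 0ℤ

record IsHadamard {N : ℕ} (H : Matrix N) : Set where
  field
    entries    : ∀ i j → H i j ≡ 1ℤ ⊎ H i j ≡ -1ℤ
    orthogonal : ∀ i j → (H · (H ᵀ)) i j ≡ ℤ.+ N ℤ.* I i j

IsSymmetric : ∀ {N} → Matrix N → Set
IsSymmetric H = ∀ i j → H i j ≡ (H ᵀ) i j

{-# OPTIONS --safe #-}
-- Put a = ±1 on two copies of the index set of H, and colour the edge
-- {(i , a) , (j , b)} by the sign of the entry a b H i j, + being red.
-- For i ≠ j the columns in which the rows (i , a) and (j , b) of this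
-- 2N × 2N matrix are both equal to a given sign c lie over the columns k of H
-- with a b H i k H j k = 1, one over each; by orthogonality there are N / 2.
-- Rows (i , 1) and (i , -1) never agree.  With N = 2 n - 2, a blue B_n would
-- give n columns where two rows are both -1.  A red B_(n-2) would give n
-- columns where two rows are both 1, since the unit diagonal makes the two
-- spine vertices themselves count among them.
module Submission where

open import Defs
open import Data.Fin using (Fin; zero; suc; punchIn; punchOut; inject≤; remQuot; combine; _↑ʳ_)
open import Data.Fin.Properties
  using (punchIn-punchOut; punchOut-injective; suc-injective; 0≢1+n; inject≤-injective; combine-remQuot; ↑ʳ-injective)
  renaming (_≟_ to _≟ᶠ_)
open import Data.Integer using (ℤ; 0ℤ; 1ℤ; -1ℤ; +_; -[1+_])
import Data.Integer as ℤ
import Data.Integer.Properties as ℤ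
open import Data.Integer.Tactic.RingSolver using (solve-∀)
open import Data.Nat using (ℕ; zero; suc; _+_; _*_; _∸_; _≤_; _<_; _≥_; z≤n; s≤s)
open import Data.Nat.Properties using (≮⇒≥; ≤⇒≯; ≤-reflexive; ≤-trans; m<1+n⇒m≤n; n≤1+n)
import Data.Nat.Tactic.RingSolver as ℕ
open import Data.Product using (∃; _×_; _,_; proj₁; proj₂; uncurry)
open import Data.Sum using (_⊎_; inj₁; inj₂; [_,_]′)
open import Data.Unit using (tt)
open import Function using (_∘_)
open import Function.Definitions using (Injective)
open import Relation.Binary.PropositionalEquality
open import Relation.Nullary using (¬_; yes; no; contradiction)

open import Algebra.Properties.CommutativeMonoid.Sum ℤ.+-0-commutativeMonoid
  using (sum; sum-cong-≗; sum-remove; ∑-distrib-+)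
open import Algebra.Properties.Semiring.Sum ℤ.+-*-semiring using (*-distribˡ-sum)

-- Sums of integers over finite index sets.

sum-const : ∀ n z → sum {n} (λ _ → z) ≡ + n ℤ.* z
sum-const zero    z = refl
sum-const (suc n) z = trans (cong (λ s → z ℤ.+ s) (sum-const n z)) (sym (ℤ.suc-* (+ n) z))

sum-nonNegative : ∀ {n} (w : Fin n → ℤ) → (∀ k → 0ℤ ℤ.≤ w k) → 0ℤ ℤ.≤ sum w
sum-nonNegative {zero}  w 0≤w = ℤ.≤-refl
sum-nonNegative {suc n} w 0≤w = ℤ.+-mono-≤ (0≤w zero) (sum-nonNegative (w ∘ suc) (0≤w ∘ suc))

-- Induction on `m`: `punchIn (h zero)` enumerates the indices other than `h zero`, and `punchOut`
-- moves the remaining values of `h` there without losing injectivity. Nonnegativity pays for the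
-- indices that `h` misses.
sum-injective-≤ : ∀ {m n} (w : Fin n → ℤ) → (∀ k → 0ℤ ℤ.≤ w k) →
                  (h : Fin m → Fin n) → Injective _≡_ _≡_ h → sum (w ∘ h) ℤ.≤ sum w
sum-injective-≤ {zero}          w 0≤w h inj = sum-nonNegative w 0≤w
sum-injective-≤ {suc m} {zero}  w 0≤w h inj = contradiction (h zero) λ ()
sum-injective-≤ {suc m} {suc n} w 0≤w h inj = begin
  w (h zero) ℤ.+ sum (w ∘ h ∘ suc)
    ≡⟨ cong (λ s → w (h zero) ℤ.+ s) (sum-cong-≗ λ k → cong w (punchIn-punchOut (h0≢ k))) ⟨
  w (h zero) ℤ.+ sum (w ∘ punchIn (h zero) ∘ h′)
    ≤⟨ ℤ.+-monoʳ-≤ (w (h zero))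
         (sum-injective-≤ (w ∘ punchIn (h zero)) (0≤w ∘ punchIn (h zero)) h′ h′-injective) ⟩
  w (h zero) ℤ.+ sum (w ∘ punchIn (h zero))
    ≡⟨ sum-remove {i = h zero} w ⟨
  sum w ∎
  where
  open ℤ.≤-Reasoning
  h0≢ : ∀ k → h zero ≢ h (suc k)
  h0≢ k e = 0≢1+n (inj e)
  h′ : Fin m → Fin n
  h′ k = punchOut (h0≢ k)
  h′-injective : Injective _≡_ _≡_ h′
  h′-injective {k} {l} e = suc-injective (inj (punchOut-injective (h0≢ k) (h0≢ l) e))

-- Signs and balanced sign sequences.

IsSign : ℤ → Set
IsSign z = z ≡ 1ℤ ⊎ z ≡ -1ℤ

sign-* : ∀ {y z} → IsSign y → IsSign z → IsSign (y ℤ.* z)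
sign-* (inj₁ refl) (inj₁ refl) = inj₁ refl
sign-* (inj₁ refl) (inj₂ refl) = inj₂ refl
sign-* (inj₂ refl) (inj₁ refl) = inj₂ refl
sign-* (inj₂ refl) (inj₂ refl) = inj₁ refl

sign-square : ∀ {z} → IsSign z → z ℤ.* z ≡ 1ℤ
sign-square (inj₁ refl) = refl
sign-square (inj₂ refl) = refl

sign-cancelʳ : ∀ {y z s} → IsSign s → y ℤ.* s ≡ z ℤ.* s → y ≡ z
sign-cancelʳ {y} {z} (inj₁ refl) e = ℤ.*-cancelʳ-≡ y z 1ℤ e
sign-cancelʳ {y} {z} (inj₂ refl) e = ℤ.*-cancelʳ-≡ y z -1ℤ e

-- The weight `1 + u k` is 2 where `u` is 1 and 0 where `u` is -1. Its total is `n` because `u` sums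
-- to 0, and each of the `m` chosen indices takes 2 of it.
balanced-bound : ∀ {m n} (u : Fin n → ℤ) → (∀ k → IsSign (u k)) → sum u ≡ 0ℤ →
                 (h : Fin m → Fin n) → Injective _≡_ _≡_ h → (∀ k → u (h k) ≡ 1ℤ) → m * 2 ≤ n
balanced-bound {m} {n} u u-sign Σu≡0 h inj u∘h≡1 = ℤ.drop‿+≤+ (begin
  + (m * 2)                            ≡⟨ ℤ.pos-* m 2 ⟩
  + m ℤ.* + 2                          ≡⟨ sum-const m (+ 2) ⟨
  sum {m} (λ _ → + 2)                  ≡⟨ sum-cong-≗ (λ k → cong (λ z → 1ℤ ℤ.+ z) (u∘h≡1 k)) ⟨
  sum (λ k → 1ℤ ℤ.+ u (h k))           ≤⟨ sum-injective-≤ (λ k → 1ℤ ℤ.+ u k) nonNegative h inj ⟩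
  sum (λ k → 1ℤ ℤ.+ u k)               ≡⟨ ∑-distrib-+ (λ _ → 1ℤ) u ⟩
  sum {n} (λ _ → 1ℤ) ℤ.+ sum u         ≡⟨ cong₂ ℤ._+_ (trans (sum-const n 1ℤ) (ℤ.*-identityʳ (+ n))) Σu≡0 ⟩
  + n ℤ.+ 0ℤ                           ≡⟨ ℤ.+-identityʳ (+ n) ⟩
  + n ∎)
  where
  open ℤ.≤-Reasoning
  nonNegative : ∀ k → 0ℤ ℤ.≤ 1ℤ ℤ.+ u k
  nonNegative k with u k | u-sign k
  ... | _ | inj₁ refl = ℤ.+≤+ z≤n
  ... | _ | inj₂ refl = ℤ.+≤+ z≤n

signOf : Fin 2 → ℤ
signOf zero       = 1ℤ
signOf (suc zero) = -1ℤ

signOf-isSign : ∀ a → IsSign (signOf a)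
signOf-isSign zero       = inj₁ refl
signOf-isSign (suc zero) = inj₂ refl

signOf-injective : Injective _≡_ _≡_ signOf
signOf-injective {zero}     {zero}     _ = refl
signOf-injective {zero}     {suc zero} ()
signOf-injective {suc zero} {zero}     ()
signOf-injective {suc zero} {suc zero} _ = refl

I-offDiagonal : ∀ {N} {i j : Fin N} → i ≢ j → I i j ≡ 0ℤ
I-offDiagonal {i = i} {j} i≢j with i ≟ᶠ j
... | yes i≡j = contradiction i≡j i≢j
... | no  _   = refl

-- The colouring applies this only to 1 and -1, so the value at 0 is immaterial.
toColour : ℤ → Colour
toColour (+ _)    = red
toColour -[1+ _ ] = blue

colourSign : Colour → ℤ
colourSign red  = 1ℤ
colourSign blue = -1ℤ

toColour⁻¹ : ∀ {z c} → IsSign z → toColour z ≡ c → z ≡ colourSign c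
toColour⁻¹ (inj₁ refl) refl = refl
toColour⁻¹ (inj₂ refl) refl = refl

remQuot-injective : ∀ {m} k → Injective _≡_ _≡_ (remQuot {m} k)
remQuot-injective {m} k {i} {j} e =
  trans (sym (combine-remQuot {m} k i)) (trans (cong (uncurry combine) e) (combine-remQuot {m} k j))

-- The doubled matrix and its agreeing columns.

module Doubling {N : ℕ} (H : Matrix N) (hadamard : IsHadamard H)
                (H-sym : IsSymmetric H) (H-diag : ∀ i → H i i ≡ 1ℤ) where

  open IsHadamard hadamard

  Vertex : Set
  Vertex = Fin N × Fin 2

  -- The Kronecker product of `H` with the 2 × 2 matrix that has 1 on and -1 off the diagonal.
  entry : Vertex → Vertex → ℤ
  entry (i , a) (j , b) = (signOf a ℤ.* signOf b) ℤ.* H i j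

  entry-isSign : ∀ x y → IsSign (entry x y)
  entry-isSign (i , a) (j , b) = sign-* (sign-* (signOf-isSign a) (signOf-isSign b)) (entries i j)

  entry-sym : ∀ x y → entry x y ≡ entry y x
  entry-sym (i , a) (j , b) = cong₂ ℤ._*_ (ℤ.*-comm (signOf a) (signOf b)) (H-sym i j)

  entry-diag : ∀ x → entry x x ≡ 1ℤ
  entry-diag (i , a) = cong₂ ℤ._*_ (sign-square (signOf-isSign a)) (H-diag i)

  entry-cancelˡ : ∀ {i a b} z → entry (i , a) z ≡ entry (i , b) z → a ≡ b
  entry-cancelˡ {i} (j , ε) e =
    signOf-injective (sign-cancelʳ (signOf-isSign ε) (sign-cancelʳ (entries i j) e))

  entry-cancelʳ : ∀ z {i a b} → entry z (i , a) ≡ entry z (i , b) → a ≡ b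
  entry-cancelʳ z {i} {a} {b} e =
    entry-cancelˡ z (trans (entry-sym (i , a) z) (trans e (entry-sym z (i , b))))

  -- The sign `ε` of the column occurs twice and squares away, so the product of two entries in a
  -- column depends only on the column of `H` underneath.
  entries-product : ∀ a b ε p q → ε ℤ.* ε ≡ 1ℤ →
    ((a ℤ.* ε) ℤ.* p) ℤ.* ((b ℤ.* ε) ℤ.* q) ≡ (a ℤ.* b) ℤ.* (p ℤ.* q)
  entries-product a b ε p q ε²≡1 = begin
    ((a ℤ.* ε) ℤ.* p) ℤ.* ((b ℤ.* ε) ℤ.* q)  ≡⟨ rearrange a b ε p q ⟩
    (ε ℤ.* ε) ℤ.* ((a ℤ.* b) ℤ.* (p ℤ.* q))  ≡⟨ cong (λ z → z ℤ.* ((a ℤ.* b) ℤ.* (p ℤ.* q))) ε²≡1 ⟩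
    1ℤ ℤ.* ((a ℤ.* b) ℤ.* (p ℤ.* q))         ≡⟨ ℤ.*-identityˡ _ ⟩
    (a ℤ.* b) ℤ.* (p ℤ.* q)                  ∎
    where
    open ≡-Reasoning
    rearrange : ∀ a b ε p q → ((a ℤ.* ε) ℤ.* p) ℤ.* ((b ℤ.* ε) ℤ.* q) ≡
                              (ε ℤ.* ε) ℤ.* ((a ℤ.* b) ℤ.* (p ℤ.* q))
    rearrange = solve-∀

  agreement-bound : ∀ {n x y} c → x ≢ y → (g : Fin n → Vertex) → Injective _≡_ _≡_ g →
    (∀ k → entry x (g k) ≡ c) → (∀ k → entry y (g k) ≡ c) → n * 2 ≤ N
  agreement-bound {zero} _ _ _ _ _ _ = z≤n
  agreement-bound {n@(suc _)} {x@(i , a)} {y@(j , b)} c x≢y g inj xg≡c yg≡c with i ≟ᶠ j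
  -- Distinct rows over the same index are opposite everywhere, so one column of agreement is
  -- already absurd. The case `n = 0` was split off so that `g zero` exists.
  ... | yes refl = contradiction
          (cong (i ,_) (entry-cancelˡ (g zero) (trans (xg≡c zero) (sym (yg≡c zero))))) x≢y
  ... | no i≢j = balanced-bound u u-isSign Σu≡0 (proj₁ ∘ g) column-injective u∘g≡1
    where
    ab : ℤ
    ab = signOf a ℤ.* signOf b
    u : Fin N → ℤ
    u k = ab ℤ.* (H i k ℤ.* H j k)
    u-isSign : ∀ k → IsSign (u k)
    u-isSign k = sign-* (sign-* (signOf-isSign a) (signOf-isSign b)) (sign-* (entries i k) (entries j k))
    Σu≡0 : sum u ≡ 0ℤ
    Σu≡0 = begin
      sum u                              ≡⟨ *-distribˡ-sum ab (λ k → H i k ℤ.* H j k) ⟨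
      ab ℤ.* (H · (H ᵀ)) i j             ≡⟨ cong (ab ℤ.*_) (orthogonal i j) ⟩
      ab ℤ.* (+ N ℤ.* I i j)             ≡⟨ cong (λ z → ab ℤ.* (+ N ℤ.* z)) (I-offDiagonal i≢j) ⟩
      ab ℤ.* (+ N ℤ.* 0ℤ)                ≡⟨ cong (ab ℤ.*_) (ℤ.*-zeroʳ (+ N)) ⟩
      ab ℤ.* 0ℤ                          ≡⟨ ℤ.*-zeroʳ ab ⟩
      0ℤ                                 ∎
      where open ≡-Reasoning
    -- Row `x` has opposite entries in the two columns over an index, so at most one of them equals
    -- `c`. Agreement of the rows alone, without the fixed value, would admit both.
    column-injective : Injective _≡_ _≡_ (proj₁ ∘ g)
    column-injective {k} {l} e = inj (same-vertex e (trans (xg≡c k) (sym (xg≡c l))))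
      where
      same-vertex : ∀ {v w} → proj₁ v ≡ proj₁ w → entry x v ≡ entry x w → v ≡ w
      same-vertex refl e = cong (_ ,_) (entry-cancelʳ x e)
    u∘g≡1 : ∀ k → u (proj₁ (g k)) ≡ 1ℤ
    u∘g≡1 k = begin
      u (proj₁ (g k))
        ≡⟨ entries-product (signOf a) (signOf b) (signOf ε) (H i l) (H j l) (sign-square (signOf-isSign ε)) ⟨
      entry x (g k) ℤ.* entry y (g k)  ≡⟨ cong (entry x (g k) ℤ.*_) (trans (yg≡c k) (sym (xg≡c k))) ⟩
      entry x (g k) ℤ.* entry x (g k)  ≡⟨ sign-square (entry-isSign x (g k)) ⟩
      1ℤ                               ∎
      where
      open ≡-Reasoning
      l = proj₁ (g k)
      ε = proj₂ (g k)

  -- Books in the colouring induced on M vertices.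

  module _ {M : ℕ} (vertex : Fin M → Vertex) (vertex-injective : Injective _≡_ _≡_ vertex) where

    χ : Colouring M
    χ = colouring (λ i j → toColour (entry (vertex i) (vertex j)))
                  (λ i j → cong toColour (entry-sym (vertex i) (vertex j)))

    mono-entry : ∀ {c i j} → Adj (colourClass χ c) i j → entry (vertex i) (vertex j) ≡ colourSign c
    mono-entry {i = i} {j} (_ , e) = toColour⁻¹ (entry-isSign (vertex i) (vertex j)) e

    redBook-bound : ∀ {m} → Contains (colourClass χ red) (Book m) → (2 + m) * 2 ≤ N
    redBook-bound (f , inj , hom) =
      agreement-bound 1ℤ (λ e → 0≢1+n (inj (vertex-injective e))) (vertex ∘ f) (inj ∘ vertex-injective) row₀ row₁
      where
      row₀ : ∀ k → entry (vertex (f zero)) (vertex (f k)) ≡ 1ℤ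
      -- No edge of the book joins a spine vertex to itself; the diagonal supplies this entry.
      row₀ zero          = entry-diag (vertex (f zero))
      row₀ (suc zero)    = mono-entry {red} (hom zero (suc zero) λ ())
      row₀ (suc (suc k)) = mono-entry {red} (hom zero (suc (suc k)) tt)
      row₁ : ∀ k → entry (vertex (f (suc zero))) (vertex (f k)) ≡ 1ℤ
      row₁ zero          = mono-entry {red} (hom (suc zero) zero λ ())
      row₁ (suc zero)    = entry-diag (vertex (f (suc zero)))
      row₁ (suc (suc k)) = mono-entry {red} (hom (suc zero) (suc (suc k)) tt)

    -- A spine vertex has diagonal entry 1 rather than -1, so only the pages, reached by `2 ↑ʳ_`,
    -- serve as columns.
    blueBook-bound : ∀ {m} → Contains (colourClass χ blue) (Book m) → m * 2 ≤ N
    blueBook-bound (f , inj , hom) =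
      agreement-bound -1ℤ (λ e → 0≢1+n (inj (vertex-injective e)))
        (vertex ∘ f ∘ (2 ↑ʳ_)) (λ {k} {l} e → ↑ʳ-injective 2 k l (inj (vertex-injective e)))
        (λ k → mono-entry {blue} (hom zero (2 ↑ʳ k) tt))
        (λ k → mono-entry {blue} (hom (suc zero) (2 ↑ʳ k) tt))

  -- Two spine vertices and `m` pages in red, or `2 + m` pages in blue, give the same inequality
  -- `(2 + m) * 2 ≤ N`. Every `M` up to `N * 2` is allowed, so that `M` can be the Ramsey number
  -- itself.
  avoidable : ∀ {m M} → N < (2 + m) * 2 → M ≤ N * 2 → ¬ Unavoidable (Book m) (Book (2 + m)) M
  avoidable {m} {M} N<2n M≤2N unavoidable =
    ≤⇒≯ ([ redBook-bound vertex injective , blueBook-bound vertex injective ]′ (unavoidable (χ vertex injective))) N<2n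
    where
    vertex : Fin M → Vertex
    vertex i = remQuot 2 (inject≤ i M≤2N)
    injective : Injective _≡_ _≡_ vertex
    injective e = inject≤-injective M≤2N M≤2N _ _ (remQuot-injective 2 e)

lemma1p1 : (n : ℕ) → 3 ≤ n → n ≢ 6 →
    (∃ λ (H : Matrix (2 * n ∸ 2)) → IsHadamard H × IsSymmetric H × (∀ i → H i i ≡ 1ℤ)) →
    R (Book (n ∸ 2)) (Book n) ≥ 4 * n ∸ 3
lemma1p1 (suc zero) (s≤s ()) _ _
lemma1p1 n@(suc (suc m)) _ _ (H , hadamard , H-sym , H-diag) = ≮⇒≥ λ R<4n∸3 →
  avoidable order< (m<1+n⇒m≤n (≤-trans R<4n∸3 (≤-reflexive double)))
    (proj₁ (R-isRamseyNumber (Book m) (Book n)))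
  where
  open Doubling H hadamard H-sym H-diag
  -- The subtracted constants 2 and, in `4n`, 3 are brought to the front so that `∸` computes.
  2n : ∀ m → 2 * (2 + m) ≡ 2 + (2 + m * 2)
  2n = ℕ.solve-∀
  4n : ∀ m → 4 * (2 + m) ≡ 3 + suc ((2 + m * 2) * 2)
  4n = ℕ.solve-∀
  order< : 2 * n ∸ 2 < n * 2
  order< = ≤-trans (≤-reflexive (cong (λ k → suc (k ∸ 2)) (2n m))) (n≤1+n _)
  double : 4 * n ∸ 3 ≡ suc ((2 * n ∸ 2) * 2)
  double = trans (cong (_∸ 3) (4n m)) (cong (λ k → suc ((k ∸ 2) * 2)) (sym (2n m)))
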